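{- Let $V$ be a finite set with a geometric interval operator $(v,w)\mapsto[v,w]$, and let $v,w\in V$ and $u\in[v,w]$. Then there exist pairwise distinct $t_1,\dots,t_m\in[v,w]$ with $t_1=v$, $t_m=w$ and $t_k=u$ for some $k$, such that $[t_1,t_2]\subsetneq[t_1,t_3]\subsetneq\cdots\subsetneq[t_1,t_m]$ is a maximal chain (no interval of the form $[t_1,s]$, $s\in V$, lies strictly between two consecutive members). In particular, the graph induced by a geometric interval operator is connected.
   Context: An interval operator on a finite set $V$ assigns to each $(v,w)\in V\times V$ a non-empty set $[v,w]\subseteq V$ with $v\in[v,w]$ and $[v,w]=[w,v]$. It is geometric if for all $t,u,v,w\in V$: $[v,v]=\{v\}$; $u\in[v,w]\Rightarrow[v,u]\subseteq[v,w]$; and ($t,u\in[v,w]$ and $t\in[v,u]$) $\Rightarrow u\in[t,w]$. A pair $v,w$ is an edge if $v\ne w$ and $[v,w]=\{v,w\}$; the edges form the induced graph on $V$. -}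

module Defs where

open import Data.Nat using (ℕ; suc; _≤_)
open import Data.Fin using (Fin; zero; fromℕ; toℕ)
open import Data.Fin.Subset using (Subset; _∈_; _⊆_; _⊂_; ⁅_⁆)
open import Data.Product using (_×_; Σ; ∃; ∃-syntax)
open import Relation.Binary.PropositionalEquality using (_≡_; _≢_)
open import Relation.Nullary using (¬_)
open import Function.Definitions using (Injective)

-- The finite set V is modelled as Fin n; subsets of V as Data.Fin.Subset.
-- An interval operator: [v,w] ∋ v and [v,w] = [w,v]
-- (non-emptiness follows from v ∈ [v,w]).
record IntervalOperator (n : ℕ) : Set where
  field
    interval : Fin n → Fin n → Subset n
    left∈    : ∀ v w → v ∈ interval v w
    symm     : ∀ v w → interval v w ≡ interval w v

record IsGeometric {n : ℕ} (I : IntervalOperator n) : Set where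
  open IntervalOperator I
  field
    point : ∀ v → interval v v ≡ ⁅ v ⁆
    mono  : ∀ u v w → u ∈ interval v w → interval v u ⊆ interval v w
    exch  : ∀ t u v w → t ∈ interval v w → u ∈ interval v w →
            t ∈ interval v u → u ∈ interval t w

IsEdge : {n : ℕ} → IntervalOperator n → Fin n → Fin n → Set
IsEdge I v w = v ≢ w × IntervalOperator.interval I v w ≡ (⁅ v ⁆ Data.Fin.Subset.∪ ⁅ w ⁆)

Connected : {n : ℕ} → IntervalOperator n → Set
Connected {n} I = ∀ (v w : Fin n) →
  ∃[ k ] Σ (Fin (suc k) → Fin n) λ p →
    p zero ≡ v × p (fromℕ k) ≡ w ×
    (∀ (i j : Fin (suc k)) → toℕ j ≡ suc (toℕ i) → IsEdge I (p i) (p j))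

-- The chain statement: t : Fin m → V with m = suc k (t₁ = t zero, t_m = t (fromℕ k)),
-- pairwise distinct, all in [v,w], containing u, and
-- [t₁,t₂] ⊊ [t₁,t₃] ⊊ ... ⊊ [t₁,t_m] maximal (nothing [t₁,s] strictly between
-- consecutive members).
MaximalChainThrough : {n : ℕ} → IntervalOperator n → Fin n → Fin n → Fin n → Set
MaximalChainThrough {n} I v w u =
  ∃[ k ] Σ (Fin (suc k) → Fin n) λ t →
    Injective _≡_ _≡_ t ×
    (∀ i → t i ∈ interval v w) ×
    t zero ≡ v × t (fromℕ k) ≡ w ×
    (∃[ i ] t i ≡ u) ×
    (∀ (i j : Fin (suc k)) → 1 ≤ toℕ i → toℕ j ≡ suc (toℕ i) →
        (interval (t zero) (t i) ⊂ interval (t zero) (t j)) ×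
        (∀ (s : Fin n) → ¬ (interval (t zero) (t i) ⊂ interval (t zero) s ×
                            interval (t zero) s ⊂ interval (t zero) (t j))))
  where open IntervalOperator I

module Submission where

-- Fix a base point v of a geometric interval operator and order V by
--   x ≤ᵥ y  iff  x ∈ [v,y].
-- Axioms of a geometric operator make this a partial order whose down-set of y
-- is exactly [v,y]; hence intervals [v,x] ⊂ [v,y] are compared by ≤ᵥ, and
-- a maximal chain [v,t₁] ⊊ [v,t₂] ⊊ ... is a chain of covers in this order.
--
-- It is built by repeatedly inserting a
--     strictly intermediate point, which terminates because the measure
--     ∣F y∣ + ∣∁ F x∣ strictly decreases.

open import Defs
open import Data.Nat using (ℕ; suc; _+_; _<_; s≤s)
import Data.Nat.Properties as ℕ
open import Data.Fin using (Fin; zero; suc; fromℕ; toℕ)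
import Data.Fin.Properties as Fin
open import Data.Fin.Subset using (Subset; _∈_; _⊆_; _⊂_; ∁; ∣_∣; ⁅_⁆; _∪_)
open import Data.Fin.Subset.Properties
open import Data.Product using (_×_; _,_; proj₁; ∃-syntax)
open import Data.Sum using (inj₁; inj₂)
open import Data.Empty using (⊥-elim)
open import Relation.Nullary using (¬_; yes; no)
open import Relation.Nullary.Decidable using (_×-dec_)
open import Relation.Binary.Definitions using (tri<; tri≈; tri>)
open import Relation.Binary.PropositionalEquality
open import Function.Definitions using (Injective)

∁-⊂ : ∀ {n} {p q : Subset n} → p ⊂ q → ∁ q ⊂ ∁ p
∁-⊂ (p⊆q , x , x∈q , x∉p) =
  (λ z∈∁q → x∉p⇒x∈∁p (λ z∈p → x∈∁p⇒x∉p z∈∁q (p⊆q z∈p))) ,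
  x , x∉p⇒x∈∁p x∉p , (λ x∈∁q → x∈∁p⇒x∉p x∈∁q x∈q)

module CoveringChains {n : ℕ} (F : Fin n → Subset n)
                      (self∈ : ∀ x → x ∈ F x)
                      (antisym : ∀ x y → x ∈ F y → y ∈ F x → x ≡ y) where

  ⊆-strict : ∀ x y → F x ⊆ F y → x ≢ y → F x ⊂ F y
  ⊆-strict x y Fx⊆Fy x≢y =
    Fx⊆Fy , y , self∈ y , λ y∈Fx → x≢y (antisym x y (Fx⊆Fy (self∈ x)) y∈Fx)

  Covers : Fin n → Fin n → Set
  Covers x y = F x ⊂ F y × (∀ s → ¬ (F x ⊂ F s × F s ⊂ F y))

  data Chain : Fin n → Fin n → Set where
    [_] : ∀ x → Chain x x
    _∷_ : ∀ {x y z} → Covers x y → Chain y z → Chain x z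

  infixr 5 _∷_ _++_

  _++_ : ∀ {x y z} → Chain x y → Chain y z → Chain x z
  [ _ ]    ++ d = d
  (c ∷ cs) ++ d = c ∷ (cs ++ d)

  steps : ∀ {x y} → Chain x y → ℕ
  steps [ _ ]    = 0
  steps (_ ∷ cs) = suc (steps cs)

  vertex : ∀ {x y} (c : Chain x y) → Fin (suc (steps c)) → Fin n
  vertex {x} c       zero    = x
  vertex (_ ∷ cs) (suc i) = vertex cs i

  -- Termination measure: strict inclusion F x ⊂ F s ⊂ F y decreases it for
  -- both halves (x,s) and (s,y).
  measure : Fin n → Fin n → ℕ
  measure x y = ∣ F y ∣ + ∣ ∁ (F x) ∣

  chainWithin : (fuel : ℕ) → ∀ x y → measure x y < fuel → F x ⊆ F y → Chain x y
  chainWithin (suc fuel) x y bound Fx⊆Fy with x Fin.≟ y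
  ... | yes refl = [ x ]
  ... | no x≢y with Fin.any? (λ s → (F x ⊂? F s) ×-dec (F s ⊂? F y))
  ...   | no noneBetween =
          (⊆-strict x y Fx⊆Fy x≢y , λ s between → noneBetween (s , between)) ∷ [ y ]
  ...   | yes (s , x⊂s , s⊂y) =
          chainWithin fuel x s left (proj₁ x⊂s) ++ chainWithin fuel s y right (proj₁ s⊂y)
    where
    left : measure x s < fuel
    left = ℕ.<-≤-trans (ℕ.+-monoˡ-< ∣ ∁ (F x) ∣ (p⊂q⇒∣p∣<∣q∣ s⊂y)) (ℕ.≤-pred bound)
    right : measure s y < fuel
    right = ℕ.<-≤-trans (ℕ.+-monoʳ-< ∣ F y ∣ (p⊂q⇒∣p∣<∣q∣ (∁-⊂ x⊂s))) (ℕ.≤-pred bound)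

  chain : ∀ x y → F x ⊆ F y → Chain x y
  chain x y = chainWithin (suc (measure x y)) x y (ℕ.n<1+n _)

  vertex-last : ∀ {x y} (c : Chain x y) → vertex c (fromℕ (steps c)) ≡ y
  vertex-last [ _ ]    = refl
  vertex-last (_ ∷ cs) = vertex-last cs

  vertex-⊆-last : ∀ {x y} (c : Chain x y) i → F (vertex c i) ⊆ F y
  vertex-⊆-last [ _ ]    zero    = λ z → z
  vertex-⊆-last (c ∷ cs) zero    = ⊆-trans (proj₁ (proj₁ c)) (vertex-⊆-last cs zero)
  vertex-⊆-last (_ ∷ cs) (suc i) = vertex-⊆-last cs i

  first-⊆-vertex : ∀ {x y} (c : Chain x y) i → F x ⊆ F (vertex c i)
  first-⊆-vertex c        zero    = λ z → z
  first-⊆-vertex (c ∷ cs) (suc i) = ⊆-trans (proj₁ (proj₁ c)) (first-⊆-vertex cs i)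

  vertex-covers : ∀ {x y} (c : Chain x y) (i j : Fin (suc (steps c))) →
                  toℕ j ≡ suc (toℕ i) → Covers (vertex c i) (vertex c j)
  vertex-covers (c ∷ cs) zero    (suc zero) refl = c
  vertex-covers (c ∷ cs) (suc i) (suc j)    eq   = vertex-covers cs i j (ℕ.suc-injective eq)

  vertex-increasing : ∀ {x y} (c : Chain x y) (i j : Fin (suc (steps c))) →
                      toℕ i < toℕ j → F (vertex c i) ⊂ F (vertex c j)
  vertex-increasing (c ∷ cs) zero    (suc j) _          = ⊂-⊆-trans (proj₁ c) (first-⊆-vertex cs j)
  vertex-increasing (c ∷ cs) (suc i) (suc j) (s≤s i<j) = vertex-increasing cs i j i<j

  vertex-injective : ∀ {x y} (c : Chain x y) → Injective _≡_ _≡_ (vertex c)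
  vertex-injective c {i} {j} eq with ℕ.<-cmp (toℕ i) (toℕ j)
  ... | tri< i<j _ _ = ⊥-elim (⊂-irref (cong F eq) (vertex-increasing c i j i<j))
  ... | tri≈ _ i≡j _ = Fin.toℕ-injective i≡j
  ... | tri> _ _ j<i = ⊥-elim (⊂-irref (cong F (sym eq)) (vertex-increasing c j i j<i))

  junction-vertex : ∀ {x y z} (c : Chain x y) (d : Chain y z) → ∃[ i ] vertex (c ++ d) i ≡ y
  junction-vertex [ _ ]    d = zero , refl
  junction-vertex (c ∷ cs) d with junction-vertex cs d
  ... | i , eq = suc i , eq

module Geometric {n : ℕ} (I : IntervalOperator n) (G : IsGeometric I) where
  open IntervalOperator I
  open IsGeometric G

  right∈ : ∀ v w → w ∈ interval v w
  right∈ v w = subst (w ∈_) (symm w v) (left∈ w v)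

  -- x ≤ᵥ y and y ≤ᵥ x force x ≡ y: exchange gives x ∈ [y,y] = {y}.
  based-antisym : ∀ v x y → x ∈ interval v y → y ∈ interval v x → x ≡ y
  based-antisym v x y x∈vy y∈vx =
    x∈⁅y⁆⇒x≡y y (subst (x ∈_) (point y) (exch y x v y (right∈ v y) x∈vy y∈vx))

  between-below : ∀ v x y s → x ∈ interval v y → s ∈ interval x y → s ∈ interval v y
  between-below v x y s x∈vy s∈xy = subst (s ∈_) (symm y v)
    (mono x y v (subst (x ∈_) (symm v y) x∈vy) (subst (s ∈_) (symm x y) s∈xy))

  between-above : ∀ v x y s → x ∈ interval v y → s ∈ interval x y → x ∈ interval v s
  between-above v x y s x∈vy s∈xy = subst (x ∈_) (symm s v)
    (exch s x y v (subst (s ∈_) (symm v y) (between-below v x y s x∈vy s∈xy))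
                  (subst (x ∈_) (symm v y) x∈vy)
                  (subst (s ∈_) (symm x y) s∈xy))

  module Based (v : Fin n) = CoveringChains (interval v) (right∈ v) (based-antisym v)

  -- A cover [v,x] ⋖ [v,y] is an edge: any s ∈ [x,y] other than x and y would
  -- give [v,x] ⊂ [v,s] ⊂ [v,y].
  cover⇒edge : ∀ v x y → Based.Covers v x y → IsEdge I x y
  cover⇒edge v x y (x⊂y , noneBetween) =
    (λ { refl → ⊂-irref refl x⊂y }) , ⊆-antisym onlyEnds endsIn
    where
    open Based v using (⊆-strict)
    x∈vy : x ∈ interval v y
    x∈vy = proj₁ x⊂y (right∈ v x)

    onlyEnds : interval x y ⊆ ⁅ x ⁆ ∪ ⁅ y ⁆
    onlyEnds {s} s∈xy with s Fin.≟ x | s Fin.≟ y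
    ... | yes refl | _        = x∈p∪q⁺ (inj₁ (x∈⁅x⁆ x))
    ... | no _     | yes refl = x∈p∪q⁺ (inj₂ (x∈⁅x⁆ y))
    ... | no s≢x   | no s≢y   = ⊥-elim (noneBetween s
          ( ⊆-strict x s (mono x v s (between-above v x y s x∈vy s∈xy)) (λ x≡s → s≢x (sym x≡s))
          , ⊆-strict s y (mono s v y (between-below v x y s x∈vy s∈xy)) s≢y))

    endsIn : ⁅ x ⁆ ∪ ⁅ y ⁆ ⊆ interval x y
    endsIn {s} s∈ with x∈p∪q⁻ ⁅ x ⁆ ⁅ y ⁆ s∈
    ... | inj₁ s∈⁅x⁆ = subst (_∈ interval x y) (sym (x∈⁅y⁆⇒x≡y x s∈⁅x⁆)) (left∈ x y)
    ... | inj₂ s∈⁅y⁆ = subst (_∈ interval x y) (sym (x∈⁅y⁆⇒x≡y y s∈⁅y⁆)) (right∈ x y)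

lemmaA1 : ∀ (n : ℕ) (I : IntervalOperator n) → IsGeometric I →
    (∀ (v w u : Fin n) → u ∈ IntervalOperator.interval I v w →
    MaximalChainThrough I v w u)
    × Connected I
lemmaA1 n I G = maximalChain , connected
  where
  open IntervalOperator I
  open IsGeometric G
  open Geometric I G

  maximalChain : ∀ v w u → u ∈ interval v w → MaximalChainThrough I v w u
  maximalChain v w u u∈vw =
    steps c , vertex c , vertex-injective c ,
    (λ i → vertex-⊆-last c i (right∈ v (vertex c i))) ,
    refl , vertex-last c , junction-vertex v→u u→w ,
    λ i j _ j≡i+1 → vertex-covers c i j j≡i+1
    where
    open Based v
    v→u : Chain v u
    v→u = chain v u (mono v v u (left∈ v u))
    u→w : Chain u w
    u→w = chain u w (mono u v w u∈vw)
    c : Chain v w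
    c = v→u ++ u→w

  connected : Connected I
  connected v w =
    steps c , vertex c , refl , vertex-last c ,
    λ i j j≡i+1 → cover⇒edge v (vertex c i) (vertex c j) (vertex-covers c i j j≡i+1)
    where
    open Based v
    c : Chain v w
    c = chain v w (mono v v w (left∈ v w))
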